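{- Suppose $(\varepsilon,\beta,\gamma;(12))\in\mathrm{Par}(n)$. Let $b$ and $c$ be the orders of $\beta$ and $\gamma$ as elements of $\mathcal S_n$. Then $c\mid 2b$, and if $c$ is odd then $c=b$.
   Context: A Latin square of order $n$ is an $n\times n$ array with rows, columns and symbols indexed by $[n]$, each symbol occurring once in each row and each column, with triple set $O(L)=\{(i,j,L(i,j))\}$. Permutations act on the right; $\varepsilon$ is the identity. A paratopism $(\alpha,\beta,\gamma;(12))$ with $\alpha,\beta,\gamma\in\mathcal S_n$ maps $L$ to $L^\sigma$ with triple set $\{(y\beta,x\alpha,z\gamma):(x,y,z)\in O(L)\}$; it is an autoparatopism of $L$ if $L^\sigma=L$. $\mathrm{Par}(n)$ denotes the set of paratopisms that are autoparatopisms of at least one Latin square of order $n$. -}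

module Defs where

open import Data.Nat using (ℕ; zero; suc; _≤_; _<_)
open import Data.Fin using (Fin)
open import Data.Fin.Permutation using (Permutation′; _⟨$⟩ʳ_; _∘ₚ_; id; _≈_)
open import Data.Product using (_×_; _,_; ∃; ∃!; ∃-syntax)
open import Level using (0ℓ)
open import Relation.Binary.PropositionalEquality using (_≡_)
open import Relation.Unary using (Pred; _∈_; _≐_)

record LatinSquare (n : ℕ) : Set where
  field
    entry     : Fin n → Fin n → Fin n
    rowLatin  : ∀ i k → ∃! _≡_ (λ j → entry i j ≡ k)
    colLatin  : ∀ j k → ∃! _≡_ (λ i → entry i j ≡ k)

Triple : ℕ → Set
Triple n = Fin n × Fin n × Fin n

O : ∀ {n} → LatinSquare n → Pred (Triple n) 0ℓ
O L (i , j , k) = LatinSquare.entry L i j ≡ k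

-- The paratopisms (α, β, γ; δ) whose S₃-component δ is the transposition (12).
record Paratopism₁₂ (n : ℕ) : Set where
  constructor ⟨_,_,_⨾[12]⟩
  field
    α β γ : Permutation′ n

act : ∀ {n} → Paratopism₁₂ n → Triple n → Triple n
act ⟨ α , β , γ ⨾[12]⟩ (x , y , z) = β ⟨$⟩ʳ y , α ⟨$⟩ʳ x , γ ⟨$⟩ʳ z

-- The triple set of L^σ.
O^ : ∀ {n} → LatinSquare n → Paratopism₁₂ n → Pred (Triple n) 0ℓ
O^ L σ t = ∃[ s ] s ∈ O L × act σ s ≡ t

-- L^σ = L: a Latin square is determined by its triple set, so equality is
-- extensional equality of the triple sets.
IsAutoparatopism : ∀ {n} → Paratopism₁₂ n → LatinSquare n → Set
IsAutoparatopism σ L = O^ L σ ≐ O L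

-- The part of Par(n) with S₃-component (12).
Par₁₂ : ∀ n → Pred (Paratopism₁₂ n) 0ℓ
Par₁₂ n σ = ∃ λ (L : LatinSquare n) → IsAutoparatopism σ L

infixr 10 _^ₚ_

_^ₚ_ : ∀ {n} → Permutation′ n → ℕ → Permutation′ n
π ^ₚ zero  = id
π ^ₚ suc k = π ∘ₚ (π ^ₚ k)

record IsOrder {n : ℕ} (π : Permutation′ n) (k : ℕ) : Set where
  field
    positive : 0 < k
    power≈id : π ^ₚ k ≈ id
    minimal  : ∀ m → 0 < m → π ^ₚ m ≈ id → k ≤ m

{-# OPTIONS --safe #-}
-- Being an autoparatopism means L(yβ, x) = L(x, y)γ.  Applying this twice gives
-- L(xβ, yβ) = L(x, y)γ², and hence γ^{2b} = ε.  If c = 2k + 1, then applying it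
-- c times gives L(yβ^{k+1}, xβ^k) = L(x, y)γ^c = L(x, y); for x = yβ^{k+1} the two
-- cells lie in the same row, so y = xβ^k = yβ^c, and therefore b ∣ c.
module Submission where

open import Defs
open import Data.Nat using (ℕ; zero; suc; _+_; _*_; _/_; _%_; NonZero; >-nonZero)
open import Data.Nat.DivMod using (m≡m%n+[m/n]*n; m%n<n)
open import Data.Nat.Divisibility using (_∣_; _∣?_; divides; ∣-antisym; m%n≡0⇒n∣m; m∣m*n)
open import Data.Nat.Primality using (euclidsLemma; prime[2])
open import Data.Nat.Properties using (*-comm; *-cancelʳ-≡; <⇒≱; n≢0⇒n>0)
open import Data.Nat.Tactic.RingSolver using (solve-∀)
open import Data.Fin.Permutation using (Permutation′; id; _⟨$⟩ʳ_; _≈_)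
open import Data.Product using (_×_; _,_; proj₁; ∃-syntax)
open import Data.Sum using (inj₁; inj₂)
open import Relation.Binary.PropositionalEquality using (_≡_; refl; sym; trans; cong; cong₂; subst; module ≡-Reasoning)
open import Relation.Nullary using (¬_; contradiction; decidable-stable)
open import Relation.Unary using (_∈_)

open ≡-Reasoning

^ₚ-+ : ∀ {n} (π : Permutation′ n) k l x →
  π ^ₚ (k + l) ⟨$⟩ʳ x ≡ π ^ₚ l ⟨$⟩ʳ (π ^ₚ k ⟨$⟩ʳ x)
^ₚ-+ π zero    l x = refl
^ₚ-+ π (suc k) l x = ^ₚ-+ π k l (π ⟨$⟩ʳ x)

^ₚ-multiple≈id : ∀ {n} (π : Permutation′ n) {k} → π ^ₚ k ≈ id → ∀ q → π ^ₚ (q * k) ≈ id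
^ₚ-multiple≈id π     πᵏ≈id zero    x = refl
^ₚ-multiple≈id π {k} πᵏ≈id (suc q) x = begin
  π ^ₚ (k + q * k) ⟨$⟩ʳ x               ≡⟨ ^ₚ-+ π k (q * k) x ⟩
  π ^ₚ (q * k) ⟨$⟩ʳ (π ^ₚ k ⟨$⟩ʳ x)      ≡⟨ ^ₚ-multiple≈id π πᵏ≈id q _ ⟩
  π ^ₚ k ⟨$⟩ʳ x                         ≡⟨ πᵏ≈id x ⟩
  x                                     ∎

-- Division with remainder: removing the multiples of `k` from `m` leaves `π ^ₚ (m % k) ≈ id`. A
-- nonzero remainder, being smaller than `k`, would contradict minimality.
order-∣ : ∀ {n} {π : Permutation′ n} {k m} → IsOrder π k → π ^ₚ m ≈ id → k ∣ m
order-∣ {π = π} {k} {m} ord πᵐ≈id = decidable-stable (k ∣? m) λ k∤m →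
  <⇒≱ (m%n<n m k) (minimal (m % k) (n≢0⇒n>0 (λ r≡0 → k∤m (m%n≡0⇒n∣m m k r≡0))) πʳ≈id)
  where
  open IsOrder ord
  instance k≢0 : NonZero k
           k≢0 = >-nonZero positive
  πʳ≈id : π ^ₚ (m % k) ≈ id
  πʳ≈id x = begin
    π ^ₚ (m % k) ⟨$⟩ʳ x                            ≡⟨ ^ₚ-multiple≈id π power≈id (m / k) _ ⟨
    π ^ₚ (m / k * k) ⟨$⟩ʳ (π ^ₚ (m % k) ⟨$⟩ʳ x)     ≡⟨ ^ₚ-+ π (m % k) (m / k * k) x ⟨
    π ^ₚ (m % k + m / k * k) ⟨$⟩ʳ x                ≡⟨ cong (λ e → π ^ₚ e ⟨$⟩ʳ x) (m≡m%n+[m/n]*n m k) ⟨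
    π ^ₚ m ⟨$⟩ʳ x                                  ≡⟨ πᵐ≈id x ⟩
    x                                              ∎

¬2∣⇒odd : ∀ m → ¬ 2 ∣ m → ∃[ k ] m ≡ suc (k * 2)
¬2∣⇒odd zero          ¬2∣m = contradiction (divides 0 refl) ¬2∣m
¬2∣⇒odd (suc zero)    ¬2∣m = 0 , refl
¬2∣⇒odd (suc (suc m)) ¬2∣m with ¬2∣⇒odd m (λ { (divides q refl) → ¬2∣m (divides (suc q) refl) })
... | k , refl = suc k , refl

-- In `2 * l ≡ q * m` the prime 2 divides `q` or `m`; the latter is excluded, so the cofactor `q`
-- can be halved.
odd∣2*⇒∣ : ∀ {m l} → ¬ 2 ∣ m → m ∣ 2 * l → m ∣ l
odd∣2*⇒∣ {m} {l} ¬2∣m (divides q 2l≡qm)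
  with euclidsLemma q m prime[2] (subst (2 ∣_) 2l≡qm (m∣m*n l))
... | inj₂ 2∣m              = contradiction 2∣m ¬2∣m
... | inj₁ (divides r refl) = divides r (*-cancelʳ-≡ l (r * m) 2 (begin
  l * 2       ≡⟨ *-comm l 2 ⟩
  2 * l       ≡⟨ 2l≡qm ⟩
  r * 2 * m   ≡⟨ swap r m ⟩
  r * m * 2   ∎))
  where
  swap : ∀ r m → r * 2 * m ≡ r * m * 2
  swap = solve-∀

module _ {n} (L : LatinSquare n) where
  open LatinSquare L

  row-injective : ∀ i {j j′} → entry i j ≡ entry i j′ → j ≡ j′
  row-injective i {j} {j′} eq with rowLatin i (entry i j′)
  ... | _ , _ , unique = trans (sym (unique eq)) (unique refl)

  col-surjective : ∀ j k → ∃[ i ] entry i j ≡ k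
  col-surjective j k with colLatin j k
  ... | i , eq , _ = i , eq

  module _ {β γ : Permutation′ n} (auto : IsAutoparatopism ⟨ id , β , γ ⨾[12]⟩ L) where

    entry-γ : ∀ x y → entry (β ⟨$⟩ʳ y) x ≡ γ ⟨$⟩ʳ entry x y
    -- The triple of the cell `(x , y)` is sent to the triple of the cell `(yβ , x)`, which must
    -- again lie in `O L`.
    entry-γ x y = proj₁ auto ((x , y , entry x y) , refl , refl)

    -- Two uses of `entry-γ` swap the coordinates twice, so `β` reaches both and the order is
    -- restored. With the exponent written `k * 2`, each step of the induction unfolds to exactly
    -- two factors `γ`.
    entry-γ²ᵏ : ∀ k x y →
      entry (β ^ₚ k ⟨$⟩ʳ x) (β ^ₚ k ⟨$⟩ʳ y) ≡ γ ^ₚ (k * 2) ⟨$⟩ʳ entry x y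
    entry-γ²ᵏ zero    x y = refl
    entry-γ²ᵏ (suc k) x y = begin
      entry (β ^ₚ suc k ⟨$⟩ʳ x) (β ^ₚ suc k ⟨$⟩ʳ y)
        ≡⟨ entry-γ²ᵏ k (β ⟨$⟩ʳ x) (β ⟨$⟩ʳ y) ⟩
      γ ^ₚ (k * 2) ⟨$⟩ʳ entry (β ⟨$⟩ʳ x) (β ⟨$⟩ʳ y)
        ≡⟨ cong (γ ^ₚ (k * 2) ⟨$⟩ʳ_) (trans (entry-γ (β ⟨$⟩ʳ y) x) (cong (γ ⟨$⟩ʳ_) (entry-γ x y))) ⟩
      γ ^ₚ (suc k * 2) ⟨$⟩ʳ entry x y ∎

    βᵏ≈id⇒γ²ᵏ≈id : ∀ k → β ^ₚ k ≈ id → γ ^ₚ (k * 2) ≈ id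
    -- Any column contains the symbol `z`; column `z` is a choice that is always at hand.
    βᵏ≈id⇒γ²ᵏ≈id k βᵏ≈id z with col-surjective z z
    ... | x , eq = begin
      γ ^ₚ (k * 2) ⟨$⟩ʳ z                    ≡⟨ cong (γ ^ₚ (k * 2) ⟨$⟩ʳ_) eq ⟨
      γ ^ₚ (k * 2) ⟨$⟩ʳ entry x z            ≡⟨ entry-γ²ᵏ k x z ⟨
      entry (β ^ₚ k ⟨$⟩ʳ x) (β ^ₚ k ⟨$⟩ʳ z)  ≡⟨ cong₂ entry (βᵏ≈id x) (βᵏ≈id z) ⟩
      entry x z                              ≡⟨ eq ⟩
      z                                      ∎

    γ²ᵏ⁺¹≈id⇒β²ᵏ⁺¹≈id : ∀ k → γ ^ₚ suc (k * 2) ≈ id → β ^ₚ suc (k * 2) ≈ id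
    γ²ᵏ⁺¹≈id⇒β²ᵏ⁺¹≈id k γᶜ≈id y = begin
      β ^ₚ suc (k * 2) ⟨$⟩ʳ y   ≡⟨ cong (λ e → β ^ₚ e ⟨$⟩ʳ y) (split k) ⟩
      β ^ₚ (suc k + k) ⟨$⟩ʳ y   ≡⟨ ^ₚ-+ β (suc k) k y ⟩
      β ^ₚ k ⟨$⟩ʳ x             ≡⟨ row-injective x same-entry ⟩
      y                         ∎
      where
      x = β ^ₚ suc k ⟨$⟩ʳ y
      split : ∀ k → suc (k * 2) ≡ suc k + k
      split = solve-∀
      same-entry : entry x (β ^ₚ k ⟨$⟩ʳ x) ≡ entry x y
      same-entry = begin
        -- The row index `x` unfolds to `β ^ₚ k` applied to `yβ`, so the cell is the image of
        -- `(yβ , x)` under `β ^ₚ k` in both coordinates. One more use of `entry-γ` supplies the odd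
        -- factor `γ`.
        entry x (β ^ₚ k ⟨$⟩ʳ x)                  ≡⟨ entry-γ²ᵏ k (β ⟨$⟩ʳ y) x ⟩
        γ ^ₚ (k * 2) ⟨$⟩ʳ entry (β ⟨$⟩ʳ y) x     ≡⟨ cong (γ ^ₚ (k * 2) ⟨$⟩ʳ_) (entry-γ x y) ⟩
        γ ^ₚ suc (k * 2) ⟨$⟩ʳ entry x y          ≡⟨ γᶜ≈id _ ⟩
        entry x y                                ∎

theorem4p1 : ∀ (n : ℕ) (β γ : Permutation′ n) → ⟨ id , β , γ ⨾[12]⟩ ∈ Par₁₂ n →
    ∀ (b c : ℕ) → IsOrder β b → IsOrder γ c →
    (c ∣ 2 * b) × (¬ (2 ∣ c) → c ≡ b)
theorem4p1 n β γ (L , auto) b c β-order γ-order = c∣2b , λ ¬2∣c →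
  -- Oddness of `c` enters twice: it cancels the 2 in `c ∣ 2 * b`, and it puts `c` in the form
  -- `suc (k * 2)` needed for `b ∣ c`.
  ∣-antisym (odd∣2*⇒∣ ¬2∣c c∣2b) (b∣c (¬2∣⇒odd c ¬2∣c))
  where
  c∣2b : c ∣ 2 * b
  c∣2b = subst (c ∣_) (*-comm b 2)
    (order-∣ γ-order (βᵏ≈id⇒γ²ᵏ≈id L auto b (IsOrder.power≈id β-order)))
  b∣c : ∃[ k ] c ≡ suc (k * 2) → b ∣ c
  b∣c (k , refl) = order-∣ β-order (γ²ᵏ⁺¹≈id⇒β²ᵏ⁺¹≈id L auto k (IsOrder.power≈id γ-order))
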